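{- Let $k \geq 3$ be an integer. Let $G$ be a connected graph with maximum degree $\Delta(G) \leq k$ such that $G$ is not isomorphic to the complete graph $K_k$. Then $V(G)$ can be partitioned into $k+1$ pairwise disjoint $k$-clique isolating sets of $G$.
   Context: All graphs are simple, finite and undirected. For $D \subseteq V(G)$, the closed neighborhood $N[D]$ is the set consisting of $D$ together with all vertices having a neighbor in $D$. A $k$-clique is a copy of the complete graph $K_k$. A subset $D \subseteq V(G)$ is a $k$-clique isolating set of $G$ if $G - N[D]$ contains no $K_k$ as a subgraph. Partitions are weak, i.e. parts may be empty; equivalently, there is a map $c: V(G) \to \{1,\ldots,k+1\}$ (not required to be surjective) such that each of the $k+1$ color classes $c^{ -1}(i)$ is a $k$-clique isolating set of $G$. -}

module Defs where

open import Data.Fin.Base using (Fin)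
open import Data.Fin.Properties using () renaming (_≟_ to _≟ᶠ_)
open import Data.List.Base using (length; filter; map; allFin)
open import Data.List.Extrema.Nat using (max)
open import Data.Nat.Base using (ℕ)
open import Data.Product.Base using (Σ-syntax; ∃-syntax; _×_)
open import Data.Refinement.Base using (Refinement-syntax; value)
open import Function.Base using (_∘_; _on_)
open import Function.Bundles using (_↔_; _⇔_; module Inverse)
open import Function.Definitions using (Injective)
open import Level using (0ℓ)
open import Relation.Binary.Construct.Closure.ReflexiveTransitive using (Star)
open import Relation.Binary.Core using (Rel)
open import Relation.Binary.Definitions using (Decidable; Irreflexive; Symmetric)
open import Relation.Binary.PropositionalEquality using (_≡_; _≢_; ≢-sym; cong)
open import Relation.Nullary.Decidable using (¬?)
open import Relation.Nullary.Negation using (¬_)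
open import Relation.Unary using (Pred; _∪_; ⋃; _∈_; _∉_; _⊥_; Universal)

-- Adjacency is required to be decidable, which is automatic classically.
-- Finiteness is imposed by taking V to be Fin n where it is needed.
record Graph (V : Set) : Set₁ where
  field
    Adj    : Rel V 0ℓ
    adj?   : Decidable Adj
    sym    : Symmetric Adj
    irrefl : Irreflexive _≡_ Adj

open Graph public using (Adj; adj?)

private
  variable
    V W : Set
    n : ℕ

K : (m : ℕ) → Graph (Fin m)
K m = record
  { Adj    = _≢_
  ; adj?   = λ u v → ¬? (u ≟ᶠ v)
  ; sym    = ≢-sym
  ; irrefl = λ u≡v u≢v → u≢v u≡v
  }

infix 4 _≅_ _⊑_

_≅_ : Graph V → Graph W → Set
_≅_ {V} {W} G H =
  Σ[ f ∈ V ↔ W ] (∀ u v → Adj G u v ⇔ Adj H (Inverse.to f u) (Inverse.to f v))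

-- H ⊑ G: some (not necessarily induced) subgraph of G is a copy of H.
_⊑_ : Graph W → Graph V → Set
_⊑_ {W} {V} H G =
  Σ[ f ∈ (W → V) ] Injective _≡_ _≡_ f × (∀ {u v} → Adj H u v → Adj G (f u) (f v))

-- The empty graph counts as connected.
Connected : Graph V → Set
Connected G = ∀ u v → Star (Adj G) u v

degree : Graph (Fin n) → Fin n → ℕ
degree {n} G v = length (filter (adj? G v) (allFin n))

Δ : Graph (Fin n) → ℕ
Δ {n} G = max 0 (map (degree G) (allFin n))

N[_] : Graph V → Pred V 0ℓ → Pred V 0ℓ
N[ G ] D = D ∪ (λ v → ∃[ u ] u ∈ D × Adj G v u)

-- The membership proofs in Refinement are irrelevant, so two vertices of
-- G − S are equal as soon as they are equal in G.
infixl 6 _−_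

_−_ : (G : Graph V) (S : Pred V 0ℓ) → Graph [ v ∈ V ∣ v ∉ S ]
G − S = record
  { Adj    = Adj G on value
  ; adj?   = λ u v → adj? G (value u) (value v)
  ; sym    = Graph.sym G
  ; irrefl = Graph.irrefl G ∘ cong value
  }

IsCliqueIsolating : ℕ → Graph V → Pred V 0ℓ → Set
IsCliqueIsolating k G D = ¬ (K k ⊑ G − N[ G ] D)

-- Weak partitions: parts may be empty.
IsPartition : {m : ℕ} → (Fin m → Pred V 0ℓ) → Set
IsPartition {m = m} D = Universal (⋃ (Fin m) D) × (∀ i j → i ≢ j → D i ⊥ D j)

{-# OPTIONS --safe #-}
module Submission where

-- A colour class is isolating iff it meets the closed neighbourhood of every
-- k-clique, so every k-clique Q must see all k+1 colours. As Δ ≤ k, a vertex of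
-- Q has at most one neighbour outside Q. If a different k-clique meets Q, their
-- union is a diamond, K_{k+1} minus at most an edge: every k-clique meeting it
-- lies inside it and sees all of it, so colour it injectively. Otherwise Q is
-- isolated; by connectivity and G ≇ K_k it has an outside neighbour w. Once w is
-- coloured, give Q the k other colours. If w is uncoloured and lies in an
-- isolated clique as well, colour both cliques at once; in all other cases w
-- can be coloured first.

open import Defs
open import Data.Empty using (⊥-elim-irr)
open import Data.Fin.Base using (Fin; zero; suc; punchIn; punchOut)
open import Data.Fin.Permutation using (_⟨$⟩ʳ_; _⟨$⟩ˡ_; inverseʳ; transpose)
open import Data.Fin.Properties
  using (_≟_; any?; all?; punchIn-injective; punchInᵢ≢i; punchIn-punchOut; injective⇒≤)
import Data.Irrelevant as Irrelevant
open import Data.List.Base using (List; []; _∷_; allFin; length; map)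
import Data.List.Base as List
open import Data.List.Extrema.Nat using (xs≤max)
import Data.List.Membership.Propositional as List
open import Data.List.Membership.Propositional.Properties using (∈-allFin; ∈-filter⁺; ∈-map⁺)
open import Data.List.Relation.Unary.All as All using (All; []; _∷_)
open import Data.List.Relation.Unary.Any using (index)
open import Data.List.Relation.Unary.Any.Properties using (lookup-index)
open import Data.Maybe.Base using (Maybe; just; nothing; _<∣>_; fromMaybe)
open import Data.Nat.Base using (ℕ; suc; _≤_; s≤s; z≤n)
open import Data.Nat.Properties using (≤-trans; <⇒≱)
open import Data.Product.Base using (Σ-syntax; ∃; ∃₂; _×_; _,_; proj₁; proj₂)
open import Data.Refinement.Base using (value; proof)
open import Data.Sum.Base using (_⊎_; inj₁; inj₂; [_,_]′)
open import Data.Vec.Base using (Vec; []; _∷_; lookup; tabulate)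
import Data.Vec.Functional as F
open import Data.Vec.Properties using (lookup∘tabulate)
open import Function.Base using (_∘_; id)
open import Function.Bundles using (mk↔ₛ′; mk⇔)
open import Function.Definitions using (Injective)
open import Level using (0ℓ)
open import Relation.Binary.Construct.Closure.ReflexiveTransitive using (Star; ε; _◅_)
open import Relation.Binary.PropositionalEquality
  using (_≡_; _≢_; refl; sym; trans; cong; subst; subst₂; ≢-sym)
open import Relation.Nullary.Decidable
  using (Dec; yes; no; map′; ¬?; decidable-stable; dec-true; _×-dec_; _⊎-dec_; _→-dec_)
open import Relation.Nullary.Negation using (¬_; contradiction)
open import Relation.Unary using (Pred)

private
  variable
    A : Set
    a b k : ℕ

-- Injections, finite search and a pigeonhole argument.

∷-injective : {x : A} {f : Fin a → A} →
  (∀ i → f i ≢ x) → Injective _≡_ _≡_ f → Injective _≡_ _≡_ (x F.∷ f)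
∷-injective f≢x inj {zero}  {zero}  _ = refl
∷-injective f≢x inj {zero}  {suc j} e = contradiction (sym e) (f≢x j)
∷-injective f≢x inj {suc i} {zero}  e = contradiction e (f≢x i)
∷-injective f≢x inj {suc i} {suc j} e = cong suc (inj e)

injection⇒≤length : {xs : List A} (f : Fin a → A) →
  Injective _≡_ _≡_ f → (∀ i → f i List.∈ xs) → a ≤ length xs
injection⇒≤length {xs = xs} f inj f∈xs =
  injective⇒≤ {f = index ∘ f∈xs} λ {i} {j} e →
    inj (trans (lookup-index (f∈xs i))
        (trans (cong (List.lookup xs) e) (sym (lookup-index (f∈xs j)))))

anyVec? : {P : Vec (Fin a) b → Set} → (∀ v → Dec (P v)) → Dec (∃ P)
anyVec? {b = 0}     P? = map′ ([] ,_) (λ { ([] , p) → p }) (P? [])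
anyVec? {b = suc _} P? =
  map′ (λ (x , v , p) → x ∷ v , p) (λ { (x ∷ v , p) → x , v , p })
       (any? λ x → anyVec? λ v → P? (x ∷ v))

-- Each predicate rules out at most one index, so one of the first three survives both.
at-most-one-failure-each : {P Q : Fin (suc (suc (suc a))) → Set} →
  (∀ i → Dec (P i)) → (∀ i → Dec (Q i)) →
  (∀ {i j} → ¬ P i → ¬ P j → i ≡ j) →
  (∀ {i j} → ¬ Q i → ¬ Q j → i ≡ j) →
  ∃ λ i → P i × Q i
at-most-one-failure-each {P = P} {Q} P? Q? P! Q!
  with verdict zero | verdict (suc zero) | verdict (suc (suc zero))
  where
  verdict : ∀ i → (P i × Q i) ⊎ (¬ P i ⊎ ¬ Q i)
  verdict i with P? i | Q? i
  ... | no ¬p | _     = inj₂ (inj₁ ¬p)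
  ... | yes _ | no ¬q = inj₂ (inj₂ ¬q)
  ... | yes p | yes q = inj₁ (p , q)
... | inj₁ pq | _ | _ = _ , pq
... | _ | inj₁ pq | _ = _ , pq
... | _ | _ | inj₁ pq = _ , pq
... | inj₂ (inj₁ x) | inj₂ (inj₁ y) | _ = contradiction (P! x y) λ()
... | inj₂ (inj₂ x) | inj₂ (inj₂ y) | _ = contradiction (Q! x y) λ()
... | inj₂ (inj₁ x) | _ | inj₂ (inj₁ y) = contradiction (P! x y) λ()
... | inj₂ (inj₂ x) | _ | inj₂ (inj₂ y) = contradiction (Q! x y) λ()
... | _ | inj₂ (inj₁ x) | inj₂ (inj₁ y) = contradiction (P! x y) λ()
... | _ | inj₂ (inj₂ x) | inj₂ (inj₂ y) = contradiction (Q! x y) λ()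

-- Colour assignments that omit one colour.

HitsAllBut : Fin (suc k) → (Fin k → Fin (suc k)) → Set
HitsAllBut p f = ∀ i → p ≢ i → ∃ λ j → f j ≡ i

punchIn-hitsAllBut : (p : Fin (suc k)) → HitsAllBut p (punchIn p)
punchIn-hitsAllBut p i p≢i = punchOut p≢i , punchIn-punchOut p≢i

-- Precomposing `punchIn p` with the transposition of `j` and the preimage of `q` keeps the image
-- and sends `j` to `q`.
hitsAllBut-through : {p q : Fin (suc k)} → p ≢ q → (j : Fin k) →
  ∃ λ f → f j ≡ q × HitsAllBut p f
hitsAllBut-through {p = p} {q} p≢q j = punchIn p ∘ (π ⟨$⟩ʳ_) , at-j , hits
  where
  π = transpose j (punchOut p≢q)

  at-j : punchIn p (π ⟨$⟩ʳ j) ≡ q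
  at-j rewrite dec-true (j ≟ j) refl = punchIn-punchOut p≢q

  hits : HitsAllBut p (punchIn p ∘ (π ⟨$⟩ʳ_))
  hits i p≢i = π ⟨$⟩ˡ punchOut p≢i ,
    trans (cong (punchIn p) (inverseʳ π)) (punchIn-punchOut p≢i)

degree≤Δ : (G : Graph (Fin a)) (v : Fin a) → degree G v ≤ Δ G
degree≤Δ G v =
  All.lookup (xs≤max 0 (map (degree G) (allFin _))) (∈-map⁺ (degree G) (∈-allFin v))

-- Cliques and their outside neighbours under the degree bound.

module _ {m n : ℕ} (G : Graph (Fin n)) (Δ≤k : Δ G ≤ suc (suc (suc m))) where

  private
    K# : ℕ
    K# = suc (suc (suc m))

  -- The vertices form a vector so that `anyVec?` can search all cliques; one vertex set arises from
  -- several values.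
  record Clique : Set where
    constructor clique
    field
      verts    : Vec (Fin n) K#
      adjacent : ∀ i j → i ≢ j → Adj G (lookup verts i) (lookup verts j)

  open Clique

  infixl 9 _!_
  _!_ : Clique → Fin K# → Fin n
  f ! i = lookup (verts f) i

  infix 4 _∈ᶜ_ _∉ᶜ_ _∈ᶜ?_
  _∈ᶜ_ _∉ᶜ_ : Fin n → Clique → Set
  x ∈ᶜ f = ∃ λ i → f ! i ≡ x
  x ∉ᶜ f = ¬ x ∈ᶜ f

  _∈ᶜ?_ : ∀ x f → Dec (x ∈ᶜ f)
  x ∈ᶜ? f = any? λ i → f ! i ≟ x

  anyClique? : {P : Vec (Fin n) K# → Set} →
    (∀ v → Dec (P v)) → Dec (∃ λ f → P (verts f))
  anyClique? P? =
    map′ (λ (v , c , p) → clique v c , p) (λ (f , p) → verts f , adjacent f , p)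
      (anyVec? λ v →
        (all? λ i → all? λ j → ¬? (i ≟ j) →-dec adj? G (lookup v i) (lookup v j))
        ×-dec P? v)

  Meets : Clique → Clique → Set
  Meets f g = ∃ λ i → f ! i ∈ᶜ g

  meeting : ∀ {x} f g → x ∈ᶜ f → x ∈ᶜ g → Meets f g
  meeting f g (i , refl) x∈g = i , x∈g

  meets-sym : ∀ f g → Meets f g → Meets g f
  meets-sym f g (i , j , e) = j , i , sym e

  !-injective : ∀ f → Injective _≡_ _≡_ (f !_)
  !-injective f {i} {j} e =
    decidable-stable (i ≟ j) λ i≢j → Graph.irrefl G e (adjacent f i j i≢j)

  ∈-adjacent : ∀ {x y} f → x ∈ᶜ f → y ∈ᶜ f → x ≢ y → Adj G x y
  ∈-adjacent f (i , refl) (j , refl) x≢y = adjacent f i j λ { refl → x≢y refl }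

  -- The closed neighbourhood of the clique.
  Near : Clique → Fin n → Set
  Near f x = ∃ λ i → f ! i ≡ x ⊎ Adj G (f ! i) x

  near-adjacent : ∀ {x y} f → x ∈ᶜ f → Adj G x y → Near f y
  near-adjacent f (i , refl) xy = i , inj₂ xy

  meets⇒near : ∀ {x} f h → Meets f h → x ∈ᶜ f → Near h x
  meets⇒near {x} f h (i , fi∈h@(j , e)) x∈f with f ! i ≟ x
  ... | yes fi≡x = j , inj₁ (trans e fi≡x)
  ... | no  fi≢x = near-adjacent h fi∈h (∈-adjacent f (i , refl) x∈f fi≢x)

  -- `v` has k - 1 neighbours inside `f`, so two distinct exits would raise its degree to at least k
  -- + 1.
  unique-exit : ∀ {v x y} f → v ∈ᶜ f → x ∉ᶜ f → y ∉ᶜ f → Adj G v x → Adj G v y → x ≡ y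
  unique-exit {v} {x} {y} f (i , refl) x∉f y∉f vx vy =
    decidable-stable (x ≟ y) λ x≢y →
      <⇒≱ (injection⇒≤length nbr (inj x≢y) λ l → ∈-filter⁺ (adj? G v) (∈-allFin _) (adj l))
          (≤-trans (degree≤Δ G v) Δ≤k)
    where
    nbr : Fin (suc K#) → Fin n
    nbr = x F.∷ y F.∷ λ l → f ! punchIn i l

    inj : x ≢ y → Injective _≡_ _≡_ nbr
    inj x≢y = ∷-injective
      (λ { zero → ≢-sym x≢y ; (suc l) e → x∉f (_ , e) })
      (∷-injective (λ l e → y∉f (_ , e)) (punchIn-injective i _ _ ∘ !-injective f))

    adj : ∀ l → Adj G v (nbr l)
    adj zero          = vx
    adj (suc zero)    = vy
    adj (suc (suc l)) = adjacent f i _ (≢-sym (punchInᵢ≢i i l))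

  -- All vertices of `f` outside `g` are exits from `g` at the same shared vertex.
  misses-at-most-once : ∀ f g → Meets f g →
    ∀ {i j} → ¬ f ! i ∈ᶜ g → ¬ f ! j ∈ᶜ g → i ≡ j
  misses-at-most-once f g (l , fl∈g) fi∉g fj∉g =
    !-injective f (unique-exit g fl∈g fi∉g fj∉g (adj fi∉g) (adj fj∉g))
    where
    adj : ∀ {i} → ¬ f ! i ∈ᶜ g → Adj G (f ! l) (f ! i)
    adj fi∉g = adjacent f l _ λ { refl → fi∉g fl∈g }

  -- The only place where k ≥ 3 matters: two sets each missing at most one
  -- vertex of f share a vertex of f.
  common-vertex : ∀ f g h → Meets f g → Meets f h → ∃ λ i → f ! i ∈ᶜ g × f ! i ∈ᶜ h
  common-vertex f g h fg fh = at-most-one-failure-each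
    (λ i → f ! i ∈ᶜ? g) (λ i → f ! i ∈ᶜ? h)
    (misses-at-most-once f g fg) (misses-at-most-once f h fh)

  -- Diamonds and isolated cliques.

  -- `w` completes `g` to a diamond: by `misses-at-most-once`, `f` consists of `w` and k - 1
  -- vertices of `g`.
  Apex : Clique → Fin n → Set
  Apex g w = w ∉ᶜ g × ∃ λ f → w ∈ᶜ f × Meets g f

  -- The clique `f` of the apex meets both `g` and `h`, so some vertex of `f` lies in both.
  apex⇒meets : ∀ {w} g h → Apex g w → w ∈ᶜ h → Meets g h
  apex⇒meets g h (_ , f , w∈f , gf) w∈h =
    let _ , x∈g , x∈h = common-vertex f g h (meets-sym g f gf) (meeting f h w∈f w∈h)
    in meeting g h x∈g x∈h

  -- `f` and `h` share a vertex of `g`, and all of `f` is near any clique that it meets.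
  apex⇒near : ∀ {w} g h → Apex g w → Meets g h → Near h w
  apex⇒near g h (_ , f , w∈f , gf) gh =
    let _ , x∈f , x∈h = common-vertex g f h gf gh
    in meets⇒near f h (meeting f h x∈f x∈h) w∈f

  -- A vertex common to `g`, `f` and `h` already has the exit `w` from `g`; a further `y` outside
  -- `g` would be a second one.
  apex⇒⊆ : ∀ {w y} g h → Apex g w → Meets g h → y ∈ᶜ h → y ∈ᶜ g ⊎ y ≡ w
  apex⇒⊆ {w} {y} g h (w∉g , f , w∈f , gf) gh y∈h with y ∈ᶜ? g
  ... | yes y∈g = inj₁ y∈g
  ... | no  y∉g with common-vertex g f h gf gh
  ...   | i , x∈f , x∈h = inj₂ (unique-exit g (i , refl) y∉g w∉g
    (∈-adjacent h x∈h y∈h λ { refl → y∉g (i , refl) })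
    (∈-adjacent f x∈f w∈f λ { refl → w∉g (i , refl) }))

  -- Every clique meeting `f` has the same vertex set; edges leaving `f` are allowed.
  Isolated : Clique → Set
  Isolated f = ∀ g → Meets f g → (∀ i → f ! i ∈ᶜ g) × (∀ i → g ! i ∈ᶜ f)

  -- Both inclusions are tested, which avoids counting: a vertex of one clique outside the other is
  -- an apex over that other clique.
  apex-or-isolated : ∀ f → (∃₂ λ g w → Meets g f × Apex g w) ⊎ Isolated f
  apex-or-isolated f
    with anyClique? (λ v →
      any? (λ i → any? λ j → lookup v j ≟ f ! i) ×-dec
      (any? (λ i → ¬? (any? λ j → lookup v j ≟ f ! i)) ⊎-dec
       any? (λ i → ¬? (lookup v i ∈ᶜ? f))))
  ... | yes (g , fg , inj₁ (i , fi∉g)) =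
    inj₁ (g , f ! i , meets-sym f g fg , fi∉g , f , (i , refl) , meets-sym f g fg)
  ... | yes (g , fg , inj₂ (i , gi∉f)) =
    inj₁ (f , g ! i , (zero , zero , refl) , gi∉f , g , (i , refl) , fg)
  ... | no ∄g = inj₂ λ g fg →
    (λ i → decidable-stable (_ ∈ᶜ? g) λ fi∉g → ∄g (g , fg , inj₁ (i , fi∉g))) ,
    (λ i → decidable-stable (_ ∈ᶜ? f) λ gi∉f → ∄g (g , fg , inj₂ (i , gi∉f)))

  -- Partial colourings and their invariant.

  Coloring : Set
  Coloring = Fin n → Maybe (Fin (suc K#))

  Colored : Coloring → Fin n → Set
  Colored c x = ∃ λ i → c x ≡ just i

  colored? : ∀ c x → Dec (Colored c x)
  colored? c x with c x
  ... | just i  = yes (i , refl)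
  ... | nothing = no λ ()

  Touched Full Saturated : Coloring → Clique → Set
  Touched c f   = ∃ λ j → Colored c (f ! j)
  Full c f      = ∀ j → Colored c (f ! j)
  Saturated c f = ∀ i → ∃ λ x → Near f x × c x ≡ just i

  touched? : ∀ c f → Dec (Touched c f)
  touched? c f = any? λ j → colored? c (f ! j)

  -- The invariant: a clique is finished as soon as one of its vertices is coloured. `Full` lets
  -- this pass on to every clique meeting it.
  Valid : Coloring → Set
  Valid c = ∀ f → Touched c f → Full c f × Saturated c f

  infix 4 _≼_
  _≼_ : Coloring → Coloring → Set
  c ≼ d = ∀ {x i} → c x ≡ just i → d x ≡ just i

  saturated-mono : ∀ {c d} f → c ≼ d → Saturated c f → Saturated d f
  saturated-mono f c≼d sat i = let x , near , e = sat i in x , near , c≼d e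

  touch : ∀ {x} c f → x ∈ᶜ f → Colored c x → Touched c f
  touch c f (i , refl) cx = i , cx

  touched-spreads : ∀ {c} f g → Valid c → Meets f g → Touched c f → Touched c g
  touched-spreads {c} f g valid (i , fi∈g) t = touch c g fi∈g (proj₁ (valid f t) i)

  -- Saturation survives extension, so only cliques with a newly coloured vertex need checking.
  valid-extend : ∀ {c d} → Valid c → c ≼ d →
    (∀ f j → Colored d (f ! j) → Colored c (f ! j) ⊎ (Full d f × Saturated d f)) →
    Valid d
  valid-extend valid c≼d new f (j , cfj) with new f j cfj
  ... | inj₂ done = done
  ... | inj₁ old  = let full , sat = valid f (j , old) in
    (λ i → let p , e = full i in p , c≼d e) , saturated-mono f c≼d sat

  -- The vertices of `f` are all near `h` and show every colour but `p`, which `w` supplies.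
  saturated : ∀ {c p w} f h (col : Fin K# → Fin (suc K#)) → HitsAllBut p col →
    (∀ j → c (f ! j) ≡ just (col j)) → Meets f h →
    c w ≡ just p → Near h w → Saturated c h
  saturated {p = p} f h col hits cf fh cw near i with p ≟ i
  ... | yes refl = _ , near , cw
  ... | no  p≢i  with hits i p≢i
  ...   | j , refl = f ! j , meets⇒near f h fh (j , refl) , cf j

  -- Vertices that are already coloured keep their colour.
  paint : (Fin a → Fin n) → (Fin a → Fin (suc K#)) → Coloring → Coloring
  paint f col c x with any? (λ i → f i ≟ x)
  ... | yes (i , _) = c x <∣> just (col i)
  ... | no  _       = c x

  paint-≼ : (f : Fin a → Fin n) (col : Fin a → Fin (suc K#)) (c : Coloring) → c ≼ paint f col c
  paint-≼ f col c {x} e with any? (λ i → f i ≟ x)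
  ... | yes _ rewrite e = refl
  ... | no  _ = e

  paint-at : (f : Fin a → Fin n) (col : Fin a → Fin (suc K#)) (c : Coloring) →
    Injective _≡_ _≡_ f → ∀ i → ¬ Colored c (f i) → paint f col c (f i) ≡ just (col i)
  paint-at f col c inj i new with any? (λ j → f j ≟ f i)
  ... | no ∄j = contradiction (i , refl) ∄j
  ... | yes (j , e) with c (f i)
  ...   | just p  = contradiction (p , refl) new
  -- The search may return another index than `i`; injectivity identifies the two.
  ...   | nothing = cong (just ∘ col) (inj e)

  paint-colored : (f : Fin a → Fin n) (col : Fin a → Fin (suc K#)) (c : Coloring) →
    ∀ {x} → Colored (paint f col c) x → Colored c x ⊎ (∃ λ i → f i ≡ x)
  paint-colored f col c {x} cx with any? (λ i → f i ≟ x)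
  ... | yes x∈f = inj₂ x∈f
  ... | no  _   = inj₁ cx

  -- The colour `zero` is the one that `suc` leaves free on the base of a diamond.
  mark : Fin n → Coloring → Coloring
  mark w = paint {1} (λ _ → w) (λ _ → zero)

  mark-≼ : ∀ w c → c ≼ mark w c
  mark-≼ w = paint-≼ {1} (λ _ → w) (λ _ → zero)

  mark-at : ∀ w c → ¬ Colored c w → mark w c w ≡ just zero
  mark-at w c = paint-at {1} (λ _ → w) (λ _ → zero) c (λ { {zero} {zero} _ → refl }) zero

  mark-colored : ∀ w c {x} → Colored (mark w c) x → Colored c x ⊎ w ≡ x
  mark-colored w c mx with paint-colored {1} (λ _ → w) (λ _ → zero) c mx
  ... | inj₁ cx        = inj₁ cx
  ... | inj₂ (_ , w≡x) = inj₂ w≡x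

  -- Extending a valid colouring locally.

  Extension : Coloring → (Coloring → Set) → Set
  Extension c P = ∃ λ d → c ≼ d × Valid d × P d

  color-diamond : ∀ {c w} g → Valid c → Apex g w → Extension c λ d → Touched d g × Colored d w
  color-diamond {c} {w} g valid apex@(w∉g , f , w∈f , gf) with touched? c g
  -- Touch spreads from `g` to `f`, which is then full, so `w` is coloured.
  ... | yes t = c , id , valid , t ,
    (let j , e = w∈f in subst (Colored c) e
      (proj₁ (valid f (touched-spreads g f valid gf t)) j))
  ... | no ¬t = d , c≼d , valid-extend valid c≼d new , (zero , _ , dg zero) , (zero , dw)
    where
    c₁ d : Coloring
    c₁ = mark w c
    d  = paint (g !_) suc c₁

    c≼d : c ≼ d
    c≼d = paint-≼ (g !_) suc c₁ ∘ mark-≼ w c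

    w-new : ¬ Colored c w
    w-new cw = ¬t (touched-spreads f g valid (meets-sym g f gf) (touch c f w∈f cw))

    dw : d w ≡ just zero
    dw = paint-≼ (g !_) suc c₁ (mark-at w c w-new)

    g-new : ∀ j → ¬ Colored c₁ (g ! j)
    g-new j cgj with mark-colored w c cgj
    ... | inj₁ old = ¬t (j , old)
    ... | inj₂ e = w∉g (j , sym e)

    dg : ∀ j → d (g ! j) ≡ just (suc j)
    dg j = paint-at (g !_) suc c₁ (!-injective g) j (g-new j)

    done : ∀ h → Meets g h → Full d h × Saturated d h
    done h gh = full , saturated g h suc (punchIn-hitsAllBut zero) dg gh dw (apex⇒near g h apex gh)
      where
      full : Full d h
      full j with apex⇒⊆ g h apex gh (j , refl)
      ... | inj₁ (i , e) = _ , subst (λ x → d x ≡ _) e (dg i)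
      ... | inj₂ e       = _ , subst (λ x → d x ≡ _) (sym e) dw

    new : ∀ h j → Colored d (h ! j) → Colored c (h ! j) ⊎ (Full d h × Saturated d h)
    new h j dhj with paint-colored (g !_) suc c₁ dhj
    ... | inj₂ hj∈g = inj₂ (done h (meeting g h hj∈g (j , refl)))
    ... | inj₁ c₁hj with mark-colored w c c₁hj
    ...   | inj₁ old = inj₁ old
    ...   | inj₂ e   = inj₂ (done h (apex⇒meets g h apex (j , sym e)))

  -- Cliques meeting `f` share its vertices, hence its colours and its outside neighbour `w`.
  isolated-done : ∀ {d p v w} f (col : Fin K# → Fin (suc K#)) → Isolated f → HitsAllBut p col →
    (∀ j → d (f ! j) ≡ just (col j)) → v ∈ᶜ f → Adj G v w → d w ≡ just p →
    ∀ h → Meets f h → Full d h × Saturated d h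
  isolated-done {d} f col iso hits df (i , refl) vw dw h fh =
    (λ j → let l , e = proj₂ (iso h fh) j in _ , subst (λ x → d x ≡ _) e (df l)) ,
    saturated f h col hits df fh dw (near-adjacent h (proj₁ (iso h fh) i) vw)

  color-isolated : ∀ {c v w} f → Valid c → Isolated f → v ∈ᶜ f → Adj G v w → Colored c w →
    Extension c λ d → Touched d f
  color-isolated {c} f valid iso v∈f vw (p , cw) with touched? c f
  ... | yes t = c , id , valid , t
  ... | no ¬t = d , c≼d , valid-extend valid c≼d new , (zero , _ , df zero)
    where
    d : Coloring
    d = paint (f !_) (punchIn p) c

    c≼d : c ≼ d
    c≼d = paint-≼ (f !_) (punchIn p) c

    df : ∀ j → d (f ! j) ≡ just (punchIn p j)
    df j = paint-at (f !_) (punchIn p) c (!-injective f) j λ cfj → ¬t (j , cfj)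

    new : ∀ h j → Colored d (h ! j) → Colored c (h ! j) ⊎ (Full d h × Saturated d h)
    new h j dhj with paint-colored (f !_) (punchIn p) c dhj
    ... | inj₁ old  = inj₁ old
    ... | inj₂ hj∈f = inj₂ (isolated-done f (punchIn p) iso (punchIn-hitsAllBut p) df
                              v∈f vw (c≼d cw) h (meeting f h hj∈f (j , refl)))

  -- The colouring of g is aligned so that the end w of the edge v w gets the
  -- colour missing on f, while v has the colour missing on g.
  color-isolated-pair : ∀ {c v w} f g → Valid c → Isolated f → Isolated g →
    v ∈ᶜ f → w ∈ᶜ g → w ∉ᶜ f → Adj G v w → Extension c λ d → Touched d f
  color-isolated-pair {c} f g valid isoᶠ isoᵍ (a , refl) (b , refl) w∉f vw
    -- With `f` coloured by `suc`, `v` gets `suc a` and `zero` is missing on `f`; so `g` must omit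
    -- `suc a` and give `zero` to `w`.
    with touched? c f | touched? c g | hitsAllBut-through {p = suc a} {zero} (λ ()) b
  ... | yes t | _      | _ = c , id , valid , t
  ... | no _  | yes t  | _ =
    color-isolated f valid isoᶠ (a , refl) vw (proj₁ (valid g t) b)
  ... | no ¬f | no ¬g  | col , col-b , hits =
    d , c≼d , valid-extend valid c≼d new , (zero , _ , df zero)
    where
    c₁ d : Coloring
    c₁ = paint (f !_) suc c
    d  = paint (g !_) col c₁

    c≼d : c ≼ d
    c≼d = paint-≼ (g !_) col c₁ ∘ paint-≼ (f !_) suc c

    disjoint : ¬ Meets f g
    -- If the cliques met, isolation would put `w` into `f`.
    disjoint fg = w∉f (proj₂ (isoᶠ g fg) b)

    df : ∀ j → d (f ! j) ≡ just (suc j)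
    df j = paint-≼ (g !_) col c₁
      (paint-at (f !_) suc c (!-injective f) j λ cfj → ¬f (j , cfj))

    g-new : ∀ j → ¬ Colored c₁ (g ! j)
    g-new j cgj with paint-colored (f !_) suc c cgj
    ... | inj₁ old  = ¬g (j , old)
    ... | inj₂ gj∈f = disjoint (meeting f g gj∈f (j , refl))

    dg : ∀ j → d (g ! j) ≡ just (col j)
    dg j = paint-at (g !_) col c₁ (!-injective g) j (g-new j)

    new : ∀ h j → Colored d (h ! j) → Colored c (h ! j) ⊎ (Full d h × Saturated d h)
    new h j dhj with paint-colored (g !_) col c₁ dhj
    ... | inj₂ hj∈g = inj₂ (isolated-done g col isoᵍ hits dg (b , refl) (Graph.sym G vw) (df a)
                              h (meeting g h hj∈g (j , refl)))
    ... | inj₁ c₁hj with paint-colored (f !_) suc c c₁hj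
    ...   | inj₁ old  = inj₁ old
    ...   | inj₂ hj∈f = inj₂ (isolated-done f suc isoᶠ (punchIn-hitsAllBut zero) df (a , refl) vw
                                (trans (dg b) (cong just col-b)) h (meeting f h hj∈f (j , refl)))

  -- Colouring `w` touches no clique, so any colour preserves validity.
  color-cliqueless : ∀ {c w} → Valid c → ¬ (∃ λ f → w ∈ᶜ f) → Extension c λ d → Colored d w
  color-cliqueless {c} {w} valid ∄f with colored? c w
  ... | yes cw = c , id , valid , cw
  ... | no ¬cw = d , c≼d , valid-extend valid c≼d new ,
      (zero , mark-at w c ¬cw)
    where
    d : Coloring
    d = mark w c

    c≼d : c ≼ d
    c≼d = mark-≼ w c

    new : ∀ h j → Colored d (h ! j) → Colored c (h ! j) ⊎ (Full d h × Saturated d h)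
    new h j dhj with mark-colored w c dhj
    ... | inj₁ old = inj₁ old
    ... | inj₂ e   = contradiction (h , j , sym e) ∄f

  _then_ : ∀ {c P Q} → Extension c P → (∀ {d} → Valid d → P d → Extension d Q) → Extension c Q
  (d , c≼d , valid , p) then next =
    let d′ , d≼d′ , valid′ , q = next valid p in d′ , d≼d′ ∘ c≼d , valid′ , q

  clique-through? : ∀ x → Dec (∃ λ f → x ∈ᶜ f)
  clique-through? x = anyClique? λ v → any? λ i → lookup v i ≟ x

  -- Colouring every clique, given an edge leaving each one.

  module _ (exit : ∀ f → ∃₂ λ v w → v ∈ᶜ f × w ∉ᶜ f × Adj G v w) where

    color-clique : ∀ {c} f → Valid c → Extension c λ d → Touched d f
    color-clique f valid with apex-or-isolated f
    ... | inj₁ (g , w , gf , apex) = color-diamond g valid apex then λ {d} valid′ (t , _) →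
      d , id , valid′ , touched-spreads g f valid′ gf t
    ... | inj₂ iso with exit f
    ...   | v , w , v∈f , w∉f , vw with clique-through? w
    ...     | no ∄g = color-cliqueless valid ∄g then λ valid′ → color-isolated f valid′ iso v∈f vw
    ...     | yes (g , w∈g) with apex-or-isolated g
    ...       | inj₂ isoᵍ = color-isolated-pair f g valid iso isoᵍ v∈f w∈g w∉f vw
    -- The diamond meeting `g` is coloured first; `g` is then full, so `w` is coloured.
    ...       | inj₁ (g′ , w′ , g′g , apex) =
      color-diamond g′ valid apex then λ {d} valid′ (t , _) →
        let j , e = w∈g in
        color-isolated f valid′ iso v∈f vw
          (subst (Colored d) e (proj₁ (valid′ g (touched-spreads g′ g valid′ g′g t)) j))

    SaturatedAt : Coloring → Fin n → Set
    SaturatedAt c x = ∀ h → x ∈ᶜ h → Saturated c h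

    -- One clique through `x` is enough: all others through `x` meet it.
    saturate-at : ∀ {c} x → Valid c → Extension c λ d → SaturatedAt d x
    saturate-at {c} x valid with clique-through? x
    ... | no ∄f = c , id , valid , λ h x∈h → contradiction (h , x∈h) ∄f
    ... | yes (f , x∈f) = color-clique f valid then λ {d} valid′ t →
      d , id , valid′ , λ h x∈h →
        proj₂ (valid′ h (touched-spreads f h valid′ (meeting f h x∈f x∈h) t))

    saturate : ∀ xs → ∃ λ c → Valid c × All (SaturatedAt c) xs
    saturate [] = (λ _ → nothing) , (λ { _ (_ , _ , ()) }) , []
    saturate (x ∷ xs) with saturate xs
    ... | c , valid , done with saturate-at x valid
    ...   | d , c≼d , valid′ , at-x = d , valid′ ,
      at-x ∷ All.map (λ at-y h y∈h → saturated-mono h c≼d (at-y h y∈h)) done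

    isolating-partition : Σ[ D ∈ (Fin (suc K#) → Pred (Fin n) 0ℓ) ]
      IsPartition D × (∀ i → IsCliqueIsolating K# G (D i))
    isolating-partition with saturate (allFin n)
    ... | c , _ , done = D , ((λ x → color x , refl) , disjoint) , isolating
      where
      -- Uncoloured vertices join class `zero`; enlarging a class keeps it isolating.
      color : Fin n → Fin (suc K#)
      color x = fromMaybe zero (c x)

      D : Fin (suc K#) → Pred (Fin n) 0ℓ
      D i x = color x ≡ i

      disjoint : ∀ i j → i ≢ j → ∀ {x} → ¬ (D i x × D j x)
      disjoint i j i≢j (refl , refl) = i≢j refl

      isolating : ∀ i → IsCliqueIsolating K# G (D i)
      isolating i (f , _ , adj) = hit (All.lookup done (∈-allFin (h ! zero)) h (zero , refl) i)
        where
        at : Fin K# → Fin n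
        at = value ∘ f

        at≡ : ∀ j → at j ≡ lookup (tabulate at) j
        at≡ j = sym (lookup∘tabulate at j)

        h : Clique
        h = clique (tabulate at) λ j l j≢l → subst₂ (Adj G) (at≡ j) (at≡ l) (adj j≢l)

        hit : ¬ (∃ λ x → Near h x × c x ≡ just i)
        hit (x , (j , near) , cx) with proof (f j)
        ... | Irrelevant.[ at∉N ] = ⊥-elim-irr (at∉N in-N)
          where
          x∈D : D i x
          x∈D = cong (fromMaybe zero) cx

          in-N : N[ G ] (D i) (at j)
          in-N = subst (N[ G ] (D i)) (sym (at≡ j))
            ([ (λ e → inj₁ (subst (D i) (sym e) x∈D)) , (λ hx → inj₂ (x , x∈D , hx)) ]′ near)

  -- Edges leaving a clique, from connectivity.

  -- If no edge leaves `f`, connectivity makes `f` all of `G`, and positions in `f` give an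
  -- isomorphism with the complete graph.
  exit-exists : Connected G → ¬ (G ≅ K K#) → ∀ f → ∃₂ λ v w → v ∈ᶜ f × w ∉ᶜ f × Adj G v w
  exit-exists conn G≇K f
    with any? (λ v → any? λ w → (v ∈ᶜ? f) ×-dec ¬? (w ∈ᶜ? f) ×-dec adj? G v w)
  ... | yes e  = e
  ... | no ∄vw = contradiction iso G≇K
    where
    closed : ∀ {v w} → Star (Adj G) v w → v ∈ᶜ f → w ∈ᶜ f
    closed ε          v∈f = v∈f
    closed (vx ◅ x*w) v∈f = closed x*w
      (decidable-stable (_ ∈ᶜ? f) λ x∉f → ∄vw (_ , _ , v∈f , x∉f , vx))

    all∈f : ∀ x → x ∈ᶜ f
    all∈f x = closed (conn (f ! zero) x) (zero , refl)

    position : Fin n → Fin K#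
    position = proj₁ ∘ all∈f

    !-position : ∀ x → f ! position x ≡ x
    !-position = proj₂ ∘ all∈f

    iso : G ≅ K K#
    iso = mk↔ₛ′ position (f !_) (λ i → !-injective f (!-position (f ! i))) !-position ,
      λ u v → mk⇔
        (λ uv e → Graph.irrefl G
          (trans (sym (!-position u)) (trans (cong (f !_) e) (!-position v))) uv)
        (λ ne → subst₂ (Adj G) (!-position u) (!-position v) (adjacent f _ _ ne))

theorem1p9 : (k : ℕ) → 3 ≤ k →
    (n : ℕ) (G : Graph (Fin n)) →
    Connected G → Δ G ≤ k → ¬ (G ≅ K k) →
    Σ[ D ∈ (Fin (suc k) → Pred (Fin n) 0ℓ) ]
    IsPartition D × (∀ i → IsCliqueIsolating k G (D i))
theorem1p9 (suc (suc (suc m))) (s≤s (s≤s (s≤s z≤n))) n G conn Δ≤k G≇K =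
  isolating-partition G Δ≤k (exit-exists G Δ≤k conn G≇K)
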